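{- Let $V$ be a finite set, let $A$ be a $V\times V$-matrix over $\mathbb{F}_2$, and let $X\subseteq V$. Then $\mathcal{M}_{A+X}=\mathcal{M}_A+X$.
   Context: A set system over a finite set $V$ is a pair $M=(V,D)$ with $D$ a family of subsets of $V$. For a $V\times V$-matrix $A$ over $\mathbb{F}_2$ and $X\subseteq V$, $A[X]$ is the principal submatrix with rows and columns in $X$ (with $\det A[\varnothing]=1$), and $\mathcal{M}_A=(V,D_A)$ with $D_A=\{X\subseteq V\mid \det A[X]\neq 0\}$. The matrix $A+X$ is obtained from $A$ by adding $1$ to each diagonal entry $a_{xx}$ with $x\in X$. Loop complementation on set systems: for $M=(V,D)$ and $j\in V$, $M+\{j\}=(V,D')$ where for all $Z\subseteq V$: if $j\in Z$, then $Z\in D'$ iff exactly one of $Z\in D$ and $Z\setminus\{j\}\in D$ holds; if $j\notin Z$, then $Z\in D'$ iff $Z\in D$. For $X=\{x_1,\dots,x_n\}\subseteq V$, $M+X$ denotes $(\cdots((M+\{x_1\})+\{x_2\})\cdots)+\{x_n\}$ (the result does not depend on the order), with $M+\varnothing=M$. -}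

module Defs where

open import Algebra.Bundles using (CommutativeRing; Semiring)
open import Data.Bool.Base using (true; false; if_then_else_)
import Data.Bool.Properties as Bool
open import Data.Fin.Base using (Fin; zero; suc; toℕ; punchIn)
open import Data.Fin.Properties using (_≟_)
open import Data.Fin.Subset using (Subset; inside; outside; _∈_; _∉_; _-_; ∣_∣)
open import Data.Fin.Subset.Properties using (_∈?_)
open import Data.List.Base using (List; foldl; tabulate)
open import Data.Nat.Base using (ℕ; zero; suc)
open import Data.Product.Base using (_×_)
open import Data.Sum.Base using (_⊎_)
open import Data.Vec.Base using ([]; _∷_)
open import Level using (0ℓ)
open import Relation.Binary.PropositionalEquality using (_≢_)
open import Relation.Nullary.Decidable using (Dec; does; ¬?; _×-dec_; _⊎-dec_; _→-dec_)
open import Relation.Nullary.Negation using (¬_)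
open import Relation.Unary using (Pred; Decidable; _≐_)

module Determinant {c ℓ} (R : CommutativeRing c ℓ) where
  open CommutativeRing R using (Carrier; _*_; -_; 1#; semiring; +-rawMonoid)
  open import Algebra.Definitions.RawMonoid +-rawMonoid using (sum)
  open import Algebra.Definitions.RawSemiring (Semiring.rawSemiring semiring) using (_^_)

  SquareMatrix : ℕ → Set c
  SquareMatrix n = Fin n → Fin n → Carrier

  -- Laplace expansion along the first row.
  det : ∀ {n} → SquareMatrix n → Carrier
  det {zero}  A = 1#
  det {suc n} A = sum λ j →
    (- 1#) ^ toℕ j * (A zero j * det λ i k → A (suc i) (punchIn j k))

𝔽₂ : CommutativeRing 0ℓ 0ℓ
𝔽₂ = Bool.xor-∧-commutativeRing

open CommutativeRing 𝔽₂ public using () renaming (_+_ to _+₂_; 0# to 0₂; 1# to 1₂)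
open Determinant 𝔽₂ public

-- The increasing enumeration of the elements of X.
nth : ∀ {n} (X : Subset n) → Fin ∣ X ∣ → Fin n
nth (inside  ∷ X) zero    = zero
nth (inside  ∷ X) (suc i) = suc (nth X i)
nth (outside ∷ X) i       = suc (nth X i)

_[_] : ∀ {n} → SquareMatrix n → (X : Subset n) → SquareMatrix ∣ X ∣
(A [ X ]) i k = A (nth X i) (nth X k)

infixl 6 _+ᵈ_
_+ᵈ_ : ∀ {n} → SquareMatrix n → Subset n → SquareMatrix n
(A +ᵈ X) i k = if does (i ≟ k ×-dec i ∈? X) then A i k +₂ 1₂ else A i k

-- Set systems over V = Fin n.  Decidability of the family, automatic in
-- classical mathematics, makes "exactly one of" behave as a sum modulo 2.
record SetSystem (n : ℕ) : Set₁ where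
  field
    D  : Pred (Subset n) 0ℓ
    D? : Decidable D

open SetSystem public

-- Without function extensionality, families of subsets are compared by
-- mutual inclusion.
infix 4 _≈ˢ_
_≈ˢ_ : ∀ {n} → SetSystem n → SetSystem n → Set
M ≈ˢ N = D M ≐ D N

ExactlyOne : Set → Set → Set
ExactlyOne P Q = (P × ¬ Q) ⊎ (¬ P × Q)

exactlyOne? : ∀ {P Q} → Dec P → Dec Q → Dec (ExactlyOne P Q)
exactlyOne? p? q? = (p? ×-dec ¬? q?) ⊎-dec (¬? p? ×-dec q?)

infixl 6 _+₁_ _+ˢ_

_+₁_ : ∀ {n} → SetSystem n → Fin n → SetSystem n
D  (M +₁ j) Z = (j ∈ Z → ExactlyOne (D M Z) (D M (Z - j))) × (j ∉ Z → D M Z)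
D? (M +₁ j) Z =
  (j ∈? Z →-dec exactlyOne? (D? M Z) (D? M (Z - j))) ×-dec (¬? (j ∈? Z) →-dec D? M Z)

-- Single-element complementations commute, so folding in increasing order
-- is only a choice of representative.
_+ˢ_ : ∀ {n} → SetSystem n → Subset n → SetSystem n
M +ˢ X = foldl _+₁_ M (tabulate (nth X))

𝓜 : ∀ {n} → SquareMatrix n → SetSystem n
D  (𝓜 A) X = det (A [ X ]) ≢ 0₂
D? (𝓜 A) X = ¬? (det (A [ X ]) Bool.≟ 0₂)

{-# OPTIONS --safe #-}
-- Adding 1 to the (p, q) entry of a matrix over 𝔽₂ adds to its determinant the
-- (p, q) minor; this is proved by induction along the first-row expansion.  For
-- p = q = j and the principal submatrix on Z ∋ j it says
-- det (A + {j})[Z] = det A[Z] + det A[Z \ {j}], while A[Z] is unaffected if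
-- j ∉ Z.  So the theorem holds for singletons, hence for all X, because A + X
-- arises from A by one diagonal change after another.
module Submission where

open import Algebra.Bundles using (CommutativeRing; Semiring)
open import Algebra.Properties.CommutativeSemigroup using (interchange)
import Algebra.Properties.CommutativeMonoid.Sum as Sum
open import Data.Bool.Base using (Bool; true; false; _∧_; _xor_)
open import Data.Bool.Properties
  using (∧-distribˡ-xor; ∧-distribʳ-xor; ∧-zeroʳ; xor-identityʳ)
open import Data.Fin.Base using (Fin; zero; suc; toℕ; punchIn; pinch; cast)
open import Data.Fin.Properties using (_≟_; punchInᵢ≢i; cast-is-id)
open import Data.Fin.Subset using (Subset; inside; outside; _∈_; _∉_; _-_; ∣_∣)
open import Data.Fin.Subset.Properties using (_∈?_; p─⊥≡p)
open import Data.List.Base using (List; []; _∷_; foldl; map; tabulate)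
open import Data.List.Properties using (map-tabulate)
open import Data.Nat.Base using (ℕ; zero; suc)
open import Data.Product.Base using (_,_)
open import Data.Sum.Base using (inj₁; inj₂)
open import Data.Vec.Base using ([]; _∷_; here; there)
open import Function.Base using (_∘_)
open import Relation.Binary.PropositionalEquality
  using (_≡_; _≢_; refl; sym; trans; cong; cong₂; subst; module ≡-Reasoning)
open import Relation.Nullary.Decidable using (does; yes; no; dec-true; dec-false)
open import Relation.Nullary.Negation using (contradiction)
open import Defs

open CommutativeRing 𝔽₂ using (+-commutativeMonoid; +-commutativeSemigroup; semiring)
open Sum +-commutativeMonoid using (sum; sum-remove; ∑-distrib-+; sum-cong-≗; sum-replicate-zero)
open import Algebra.Definitions.RawSemiring
  (Semiring.rawSemiring semiring) using (_^_)

open ≡-Reasoning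

-- Determinants over 𝔽₂ under the change of one entry.

minor : ∀ {n} → Fin (suc n) → Fin (suc n) → SquareMatrix (suc n) → SquareMatrix n
minor p q A i k = A (punchIn p i) (punchIn q k)

flipEntry : ∀ {n} → Fin n → Fin n → SquareMatrix n → SquareMatrix n
flipEntry p q A i k = A i k xor (does (i ≟ p) ∧ does (k ≟ q))

1^ : ∀ n → 1₂ ^ n ≡ 1₂
1^ zero    = refl
1^ (suc n) = 1^ n

-- In characteristic 2 negation is the identity, so every sign of the Laplace expansion is a power
-- of `1₂`.
det-expand : ∀ {n} (A : SquareMatrix (suc n)) →
             det A ≡ sum λ j → A zero j ∧ det (minor zero j A)
det-expand A = sum-cong-≗ λ j → cong (_∧ (A zero j ∧ det (minor zero j A))) (1^ (toℕ j))

det-cong : ∀ {n} {A B : SquareMatrix n} → (∀ i k → A i k ≡ B i k) → det A ≡ det B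
det-cong {zero}  A≗B = refl
det-cong {suc n} A≗B = sum-cong-≗ λ j →
  cong (1₂ ^ toℕ j ∧_) (cong₂ _∧_ (A≗B zero j) (det-cong λ i k → A≗B (suc i) (punchIn j k)))

-- Expanding `A [ Z ]` at `j ∈ Z` needs indices in `Fin (suc ∣ Z - j ∣)`, a type that agrees with
-- `Fin ∣ Z ∣` only up to a propositional equality of sizes.
det-cast : ∀ {m n} (e : m ≡ n) (A : SquareMatrix n) →
           det A ≡ det (λ i k → A (cast e i) (cast e k))
det-cast refl A = det-cong λ i k → sym (cong₂ A (cast-is-id refl i) (cast-is-id refl k))

does-punchIn≟ : ∀ {n} (p : Fin (suc n)) i → does (punchIn p i ≟ p) ≡ false
does-punchIn≟ p i = dec-false (punchIn p i ≟ p) (punchInᵢ≢i p i)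

-- pinch k q is the position of q once punchIn q k has been removed.
does-punchIn≟-pinch : ∀ {n} (q : Fin (suc (suc n))) k l →
  does (punchIn (punchIn q k) l ≟ q) ≡ does (l ≟ pinch k q)
does-punchIn≟-pinch zero    k       zero    = refl
does-punchIn≟-pinch zero    k       (suc l) = refl
does-punchIn≟-pinch (suc q) zero    l       = refl
does-punchIn≟-pinch (suc q) (suc k) zero    = refl
does-punchIn≟-pinch {suc n} (suc q) (suc k) (suc l) = does-punchIn≟-pinch q k l

-- Both sides enumerate in increasing order the indices other than `q` and `punchIn q k`; only the
-- order of the two removals differs.
punchIn-punchIn : ∀ {n} (q : Fin (suc (suc n))) k l →
  punchIn (punchIn q k) (punchIn (pinch k q) l) ≡ punchIn q (punchIn k l)
punchIn-punchIn zero    k       l       = refl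
punchIn-punchIn (suc q) zero    l       = refl
punchIn-punchIn (suc q) (suc k) zero    = refl
punchIn-punchIn {suc n} (suc q) (suc k) (suc l) = cong suc (punchIn-punchIn q k l)

-- Here `t` and `s` stand for the terms of the expansion before and after a change in column `q`. A
-- change in row zero has `u` zero; a change in a lower row has `x` zero.
sum-perturb : ∀ {n} (q : Fin (suc n)) (s t : Fin (suc n) → Bool) x (u : Fin n → Bool) →
  s q ≡ t q xor x → (∀ k → s (punchIn q k) ≡ t (punchIn q k) xor u k) →
  sum s ≡ sum t xor (x xor sum u)
sum-perturb q s t x u at-q off-q = begin
  sum s
    ≡⟨ sum-remove s ⟩
  s q xor sum (s ∘ punchIn q)
    ≡⟨ cong₂ _xor_ at-q (trans (sum-cong-≗ off-q) (∑-distrib-+ (t ∘ punchIn q) u)) ⟩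
  (t q xor x) xor (sum (t ∘ punchIn q) xor sum u)
    ≡⟨ interchange +-commutativeSemigroup (t q) x _ _ ⟩
  (t q xor sum (t ∘ punchIn q)) xor (x xor sum u)
    ≡⟨ cong (_xor _) (sum-remove t) ⟨
  sum t xor (x xor sum u) ∎

minor-flipEntry-col : ∀ {n} r p q (A : SquareMatrix (suc n)) i k →
  minor r q (flipEntry p q A) i k ≡ minor r q A i k
minor-flipEntry-col r p q A i k
  rewrite does-punchIn≟ q k | ∧-zeroʳ (does (punchIn r i ≟ p)) = xor-identityʳ _

minor-flipEntry : ∀ {n} (p : Fin (suc n)) q k (A : SquareMatrix (suc (suc n))) i l →
  minor zero (punchIn q k) (flipEntry (suc p) q A) i l ≡
  flipEntry p (pinch k q) (minor zero (punchIn q k) A) i l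
minor-flipEntry p q k A i l =
  cong (λ b → minor zero (punchIn q k) A i l xor (does (i ≟ p) ∧ b)) (does-punchIn≟-pinch q k l)

det-flipEntry : ∀ {n} p q (A : SquareMatrix (suc n)) →
  det (flipEntry p q A) ≡ det A xor det (minor p q A)
det-flipEntry {n} zero q A = begin
  det (flipEntry zero q A)
    ≡⟨ det-expand (flipEntry zero q A) ⟩
  sum s
    -- The minors omit row zero, so only the coefficient in column `q` changes.
    ≡⟨ sum-perturb q s t (det (minor zero q A)) (λ _ → false) at-q off-q ⟩
  sum t xor (det (minor zero q A) xor sum {n} (λ _ → false))
    ≡⟨ cong₂ _xor_ (sym (det-expand A))
         (trans (cong (det (minor zero q A) xor_) (sum-replicate-zero n)) (xor-identityʳ _)) ⟩
  det A xor det (minor zero q A) ∎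
  where
  s t : Fin (suc n) → Bool
  s j = flipEntry zero q A zero j ∧ det (minor zero j (flipEntry zero q A))
  t j = A zero j ∧ det (minor zero j A)

  unchanged : ∀ j → det (minor zero j (flipEntry zero q A)) ≡ det (minor zero j A)
  unchanged j = det-cong λ i k → xor-identityʳ (minor zero j A i k)

  at-q : s q ≡ t q xor det (minor zero q A)
  at-q = trans
    (cong₂ (λ b d → (A zero q xor b) ∧ d) (dec-true (q ≟ q) refl) (unchanged q))
    (∧-distribʳ-xor (det (minor zero q A)) (A zero q) true)

  off-q : ∀ k → s (punchIn q k) ≡ t (punchIn q k) xor false
  off-q k = let j = punchIn q k in trans
    (cong₂ _∧_ (trans (cong (A zero j xor_) (does-punchIn≟ q k)) (xor-identityʳ (A zero j)))
               (unchanged j))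
    (sym (xor-identityʳ (t j)))
det-flipEntry {suc n} (suc p) q A = begin
  det (flipEntry (suc p) q A)
    ≡⟨ det-expand (flipEntry (suc p) q A) ⟩
  sum s
    -- The minor at `q` loses the changed entry. Every other minor keeps it, and by induction its
    -- change `u k` is a term in the expansion of `minor (suc p) q A`.
    ≡⟨ sum-perturb q s t false u at-q off-q ⟩
  sum t xor sum u
    ≡⟨ cong₂ _xor_ (det-expand A) (det-expand (minor (suc p) q A)) ⟨
  det A xor det (minor (suc p) q A) ∎
  where
  s t : Fin (suc (suc n)) → Bool
  s j = flipEntry (suc p) q A zero j ∧ det (minor zero j (flipEntry (suc p) q A))
  t j = A zero j ∧ det (minor zero j A)

  u : Fin (suc n) → Bool
  u k = A zero (punchIn q k) ∧ det (minor zero k (minor (suc p) q A))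

  at-q : s q ≡ t q xor false
  at-q = trans
    (cong₂ _∧_ (xor-identityʳ (A zero q)) (det-cong (minor-flipEntry-col zero (suc p) q A)))
    (sym (xor-identityʳ (t q)))

  off-q : ∀ k → s (punchIn q k) ≡ t (punchIn q k) xor u k
  off-q k = let j = punchIn q k in begin
    s j
      ≡⟨ cong₂ _∧_ (xor-identityʳ (A zero j)) (det-cong (minor-flipEntry p q k A)) ⟩
    A zero j ∧ det (flipEntry p (pinch k q) (minor zero j A))
      ≡⟨ cong (A zero j ∧_) (det-flipEntry p (pinch k q) (minor zero j A)) ⟩
    A zero j ∧ (det (minor zero j A) xor det (minor p (pinch k q) (minor zero j A)))
      ≡⟨ cong (λ d → A zero j ∧ (det (minor zero j A) xor d))
           (det-cong λ i l → cong (A (suc (punchIn p i))) (punchIn-punchIn q k l)) ⟩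
    A zero j ∧ (det (minor zero j A) xor det (minor zero k (minor (suc p) q A)))
      ≡⟨ ∧-distribˡ-xor (A zero j) _ _ ⟩
    t j xor u k ∎

-- Principal submatrices and removal of an element.

nth-∈ : ∀ {n} (Z : Subset n) i → nth Z i ∈ Z
nth-∈ (inside  ∷ Z) zero    = here
nth-∈ (inside  ∷ Z) (suc i) = there (nth-∈ Z i)
nth-∈ (outside ∷ Z) i       = there (nth-∈ Z i)

-- W enumerates as Z does, except that the position of j is skipped.
record Deletion {n} (Z : Subset n) (j : Fin n) (W : Subset n) : Set where
  field
    size     : suc ∣ W ∣ ≡ ∣ Z ∣
    position : Fin (suc ∣ W ∣)
    does-nth : ∀ i → does (nth Z (cast size i) ≟ j) ≡ does (i ≟ position)
    nth-skip : ∀ i → nth Z (cast size (punchIn position i)) ≡ nth W i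

deletion : ∀ {n} {Z : Subset n} {j} → j ∈ Z → Deletion Z j (Z - j)
deletion {Z = inside ∷ Z} here =
  -- The tail of `(inside ∷ Z) - zero` computes to `Z` minus the empty set, which is only
  -- propositionally `Z`.
  subst (λ W → Deletion (inside ∷ Z) zero (outside ∷ W)) (sym (p─⊥≡p Z)) record
    { size     = refl
    ; position = zero
    ; does-nth = λ { zero → refl ; (suc i) → refl }
    ; nth-skip = λ i → cong (suc ∘ nth Z) (cast-is-id refl i)
    }
deletion {Z = inside ∷ Z} (there j∈Z) = record
  { size     = cong suc size
  ; position = suc position
  ; does-nth = λ { zero → refl ; (suc i) → does-nth i }
  ; nth-skip = λ { zero → refl ; (suc i) → cong suc (nth-skip i) }
  }
  where open Deletion (deletion j∈Z)
deletion {Z = outside ∷ Z} (there j∈Z) = record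
  { size     = size
  ; position = position
  ; does-nth = does-nth
  ; nth-skip = cong suc ∘ nth-skip
  }
  where open Deletion (deletion j∈Z)

module _ {n} (A : SquareMatrix n) {Z : Subset n} {j : Fin n} where

  -- After reindexing, `does-nth` places the changed entry at `(position, position)`, and `nth-skip`
  -- identifies the minor there with `A [ Z - j ]`.
  det-flipEntry-∈ : j ∈ Z →
    det (flipEntry j j A [ Z ]) ≡ det (A [ Z ]) xor det (A [ Z - j ])
  det-flipEntry-∈ j∈Z = begin
    det (flipEntry j j A [ Z ])
      ≡⟨ det-cast size (flipEntry j j A [ Z ]) ⟩
    det (λ i k → (flipEntry j j A [ Z ]) (cast size i) (cast size k))
      ≡⟨ det-cong (λ i k → cong₂ (λ a b → B i k xor (a ∧ b)) (does-nth i) (does-nth k)) ⟩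
    det (flipEntry position position B)
      ≡⟨ det-flipEntry position position B ⟩
    det B xor det (minor position position B)
      ≡⟨ cong₂ _xor_ (sym (det-cast size (A [ Z ])))
           (det-cong λ i k → cong₂ A (nth-skip i) (nth-skip k)) ⟩
    det (A [ Z ]) xor det (A [ Z - j ]) ∎
    where
    open Deletion (deletion j∈Z)
    B : SquareMatrix (suc ∣ Z - j ∣)
    B i k = (A [ Z ]) (cast size i) (cast size k)

  det-flipEntry-∉ : j ∉ Z → det (flipEntry j j A [ Z ]) ≡ det (A [ Z ])
  det-flipEntry-∉ j∉Z = det-cong λ i k → trans
    (cong (λ a → (A [ Z ]) i k xor (a ∧ does (nth Z k ≟ j)))
          (dec-false (nth Z i ≟ j) λ eq → j∉Z (subst (_∈ Z) eq (nth-∈ Z i))))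
    (xor-identityʳ _)

-- Set systems and loop complementation at one element.

xor⇒exactlyOne : ∀ x y → x xor y ≢ 0₂ → ExactlyOne (x ≢ 0₂) (y ≢ 0₂)
xor⇒exactlyOne true  true  h = contradiction refl h
xor⇒exactlyOne true  false h = inj₁ (h , λ ¬eq → ¬eq refl)
xor⇒exactlyOne false y     h = inj₂ ((λ ¬eq → ¬eq refl) , h)

exactlyOne⇒xor : ∀ x y → ExactlyOne (x ≢ 0₂) (y ≢ 0₂) → x xor y ≢ 0₂
exactlyOne⇒xor true  true  (inj₁ (_ , h)) = contradiction (λ ()) h
exactlyOne⇒xor true  true  (inj₂ (h , _)) = contradiction (λ ()) h
exactlyOne⇒xor true  false _              = λ ()
exactlyOne⇒xor false y     (inj₁ (h , _)) = contradiction refl h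
exactlyOne⇒xor false y     (inj₂ (_ , h)) = h

≈ˢ-trans : ∀ {n} {L M N : SetSystem n} → L ≈ˢ M → M ≈ˢ N → L ≈ˢ N
≈ˢ-trans (f , f′) (g , g′) = (λ d → g (f d)) , (λ d → f′ (g′ d))

-- `ExactlyOne` also uses its arguments negated, so a single inclusion between the results takes
-- both inclusions between `M` and `N`.
+₁-mono : ∀ {n} {M N : SetSystem n} (j : Fin n) → M ≈ˢ N → ∀ {Z} → D (M +₁ j) Z → D (N +₁ j) Z
+₁-mono j (f , f′) (in-case , out-case) = (λ j∈Z → exactlyOne-map (in-case j∈Z)) , (λ j∉Z → f (out-case j∉Z))
  where
  exactlyOne-map : ExactlyOne _ _ → ExactlyOne _ _
  exactlyOne-map (inj₁ (p , ¬q)) = inj₁ (f p , λ q → ¬q (f′ q))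
  exactlyOne-map (inj₂ (¬p , q)) = inj₂ ((λ p → ¬p (f′ p)) , f q)

+₁-cong : ∀ {n} {M N : SetSystem n} (j : Fin n) → M ≈ˢ N → M +₁ j ≈ˢ N +₁ j
+₁-cong {M = M} {N} j M≈N@(f , f′) = +₁-mono {M = M} {N} j M≈N , +₁-mono {M = N} {M} j (f′ , f)

foldl-+₁-cong : ∀ {n} {M N : SetSystem n} (js : List (Fin n)) →
                M ≈ˢ N → foldl _+₁_ M js ≈ˢ foldl _+₁_ N js
foldl-+₁-cong []       M≈N = M≈N
foldl-+₁-cong {M = M} {N} (j ∷ js) M≈N =
  foldl-+₁-cong {M = M +₁ j} {N +₁ j} js (+₁-cong {M = M} {N} j M≈N)

𝓜-cong : ∀ {n} {A B : SquareMatrix n} → (∀ i k → A i k ≡ B i k) → 𝓜 A ≈ˢ 𝓜 B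
𝓜-cong A≗B = (λ {Z} → subst (_≢ 0₂) (eq Z)) , (λ {Z} → subst (_≢ 0₂) (sym (eq Z)))
  where eq = λ Z → det-cong λ i k → A≗B (nth Z i) (nth Z k)

-- This is the matrix `A + {j}`: over 𝔽₂, adding 1 to a diagonal entry flips it.
loop : ∀ {n} → SquareMatrix n → Fin n → SquareMatrix n
loop A j = flipEntry j j A

𝓜-loop : ∀ {n} (A : SquareMatrix n) j → 𝓜 (loop A j) ≈ˢ 𝓜 A +₁ j
𝓜-loop A j = to , from
  where
  to : ∀ {Z} → D (𝓜 (loop A j)) Z → D (𝓜 A +₁ j) Z
  -- A sum in 𝔽₂ is nonzero iff exactly one summand is, so the identity of determinants becomes the
  -- clause for `j ∈ Z`.
  to h = (λ j∈Z → xor⇒exactlyOne _ _ (subst (_≢ 0₂) (det-flipEntry-∈ A j∈Z) h))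
       , (λ j∉Z → subst (_≢ 0₂) (det-flipEntry-∉ A j∉Z) h)

  from : ∀ {Z} → D (𝓜 A +₁ j) Z → D (𝓜 (loop A j)) Z
  from {Z} (in-case , out-case) with j ∈? Z
  ... | yes j∈Z = subst (_≢ 0₂) (sym (det-flipEntry-∈ A j∈Z)) (exactlyOne⇒xor _ _ (in-case j∈Z))
  ... | no  j∉Z = subst (_≢ 0₂) (sym (det-flipEntry-∉ A j∉Z)) (out-case j∉Z)

𝓜-foldl-loop : ∀ {n} (A : SquareMatrix n) js → 𝓜 (foldl loop A js) ≈ˢ foldl _+₁_ (𝓜 A) js
𝓜-foldl-loop A []       = (λ d → d) , (λ d → d)
-- `foldl` changes its accumulator first: the induction hypothesis is taken at `loop A j`, and the
-- singleton case is then carried through the complementations in `js`.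
𝓜-foldl-loop A (j ∷ js) = ≈ˢ-trans
  {L = 𝓜 (foldl loop (loop A j) js)} {foldl _+₁_ (𝓜 (loop A j)) js} {foldl _+₁_ (𝓜 A +₁ j) js}
  (𝓜-foldl-loop (loop A j) js)
  (foldl-+₁-cong {M = 𝓜 (loop A j)} {𝓜 A +₁ j} js (𝓜-loop A j))

-- `A +ᵈ X` as a sequence of diagonal changes.

foldl-loop-cong : ∀ {n} {A B : SquareMatrix n} js → (∀ i k → A i k ≡ B i k) →
                  ∀ i k → foldl loop A js i k ≡ foldl loop B js i k
foldl-loop-cong []       A≗B = A≗B
foldl-loop-cong (j ∷ js) A≗B = foldl-loop-cong js λ i k → cong (_xor _) (A≗B i k)

-- Diagonal changes at successor indices act only on the lower right block; the next two lemmas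
-- treat the first row and the rest of the first column.
foldl-loop-suc : ∀ {n} (A : SquareMatrix (suc n)) js i k →
  foldl loop A (map suc js) (suc i) (suc k) ≡ foldl loop (minor zero zero A) js i k
foldl-loop-suc A []       i k = refl
foldl-loop-suc A (j ∷ js) i k = foldl-loop-suc (loop A (suc j)) js i k

foldl-loop-row : ∀ {n} (A : SquareMatrix (suc n)) js k → foldl loop A (map suc js) zero k ≡ A zero k
foldl-loop-row A []       k = refl
foldl-loop-row A (j ∷ js) k = trans (foldl-loop-row (loop A (suc j)) js k) (xor-identityʳ _)

foldl-loop-col : ∀ {n} (A : SquareMatrix (suc n)) js i →
  foldl loop A (map suc js) (suc i) zero ≡ A (suc i) zero
foldl-loop-col A []       i = refl
foldl-loop-col A (j ∷ js) i = trans (foldl-loop-col (loop A (suc j)) js i)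
  (trans (cong (A (suc i) zero xor_) (∧-zeroʳ (does (i ≟ j)))) (xor-identityʳ _))

+ᵈ-foldl : ∀ {n} (A : SquareMatrix n) X i k → (A +ᵈ X) i k ≡ foldl loop A (tabulate (nth X)) i k
+ᵈ-foldl A (outside ∷ X) i k =
  -- The enumeration of `outside ∷ X` is that of `X` composed with `suc`; `map-tabulate` brings it
  -- to the form `map suc js`.
  subst (λ js → (A +ᵈ (outside ∷ X)) i k ≡ foldl loop A js i k) (map-tabulate (nth X) suc) (shifted i k)
  where
  js = tabulate (nth X)
  shifted : ∀ i k → (A +ᵈ (outside ∷ X)) i k ≡ foldl loop A (map suc js) i k
  shifted zero    zero    = sym (foldl-loop-row A js zero)
  shifted zero    (suc k) = sym (foldl-loop-row A js (suc k))
  shifted (suc i) zero    = sym (foldl-loop-col A js i)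
  shifted (suc i) (suc k) =
    trans (+ᵈ-foldl (minor zero zero A) X i k) (sym (foldl-loop-suc A js i k))
+ᵈ-foldl A (inside ∷ X) i k =
  subst (λ js → (A +ᵈ (inside ∷ X)) i k ≡ foldl loop A₀ js i k) (map-tabulate (nth X) suc) (shifted i k)
  where
  js = tabulate (nth X)
  -- The enumeration of `inside ∷ X` begins with `zero`, so this change comes first.
  A₀ = loop A zero
  shifted : ∀ i k → (A +ᵈ (inside ∷ X)) i k ≡ foldl loop A₀ (map suc js) i k
  shifted zero    zero    = sym (foldl-loop-row A₀ js zero)
  shifted zero    (suc k) = sym (trans (foldl-loop-row A₀ js (suc k)) (xor-identityʳ _))
  shifted (suc i) zero    = sym (trans (foldl-loop-col A₀ js i) (xor-identityʳ _))
  shifted (suc i) (suc k) = begin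
    (minor zero zero A +ᵈ X) i k
      ≡⟨ +ᵈ-foldl (minor zero zero A) X i k ⟩
    foldl loop (minor zero zero A) js i k
      -- The change at `(zero, zero)` lies outside the lower right block.
      ≡⟨ foldl-loop-cong js (λ _ _ → xor-identityʳ _) i k ⟨
    foldl loop (minor zero zero A₀) js i k
      ≡⟨ foldl-loop-suc A₀ js i k ⟨
    foldl loop A₀ (map suc js) (suc i) (suc k) ∎

theorem8 : ∀ {n : ℕ} (A : SquareMatrix n) (X : Subset n) → 𝓜 (A +ᵈ X) ≈ˢ 𝓜 A +ˢ X
theorem8 A X = ≈ˢ-trans {L = 𝓜 (A +ᵈ X)} {𝓜 (foldl loop A (tabulate (nth X)))} {𝓜 A +ˢ X}
  (𝓜-cong (+ᵈ-foldl A X)) (𝓜-foldl-loop A (tabulate (nth X)))
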